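{- Let $A$ be a set, $I$ a set of labels, $\{\to_\alpha\mid\alpha\in I\}$ a family of binary relations on $A$ and $\{\vdash\!\dashv_\alpha\mid\alpha\in I\}$ a family of symmetric binary relations on $A$; put $\to=\bigcup_{\alpha}\to_\alpha$ and $\sim=(\bigcup_\alpha \vdash\!\dashv_\alpha)^*$. If the labeled ARS is peak-and-cliff decreasing, then it is Church–Rosser modulo $\sim$, i.e. $\Leftrightarrow^*\subseteq \to^*\cdot\sim\cdot\leftarrow^*$, where $\Leftrightarrow=\leftarrow\cup\to\cup\sim$.
   Context: For $J\subseteq I$ write $\to_J=\bigcup_{\gamma\in J}\to_\gamma$ and $\Leftrightarrow_J = \leftarrow_J\cup\to_J\cup\bigcup_{\gamma\in J}\vdash\!\dashv_\gamma$; $\leftarrow_\beta$ is the inverse of $\to_\beta$ and $R^=$ the reflexive closure. The labeled ARS is peak-and-cliff decreasing if there is a well-founded order $>$ on $I$ such that for all $\alpha,\beta\in I$: $\leftarrow_\alpha\cdot\to_\beta \subseteq (\Leftrightarrow_{\vee\alpha\beta})^*$ and $\leftarrow_\alpha\cdot\vdash\!\dashv_\beta\subseteq (\Leftrightarrow_{\vee\alpha})^*\cdot \leftarrow_\beta^{=}$, where $\vee\alpha\beta=\{\gamma\in I\mid \alpha>\gamma \text{ or } \beta>\gamma\}$ and $\vee\alpha=\vee\alpha\alpha$. -}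

module Defs where

open import Data.Product.Base using (∃; _×_)
open import Data.Sum.Base using (_⊎_)
open import Function.Base using (flip)
open import Induction.WellFounded using (WellFounded)
open import Level using (Level; _⊔_; suc)
open import Relation.Binary.Construct.Closure.Reflexive using (ReflClosure)
open import Relation.Binary.Construct.Closure.ReflexiveTransitive using (Star)
open import Relation.Binary.Construct.Composition using () renaming (_;_ to _·_)
open import Relation.Binary.Construct.Union using (_∪_)
open import Relation.Binary.Core using (Rel; _⇒_)
open import Relation.Binary.Definitions using (Symmetric)
open import Relation.Binary.PropositionalEquality.Core using (_≡_)
open import Relation.Binary.Structures using (IsStrictPartialOrder)
open import Relation.Unary using (Pred; _∈_)

-- `WellFounded` asks every element to be accessible from below, so it is
-- applied to the converse of _>_.
record IsWellFoundedOrder {i ℓ : Level} {I : Set i} (_>_ : Rel I ℓ) : Set (i ⊔ ℓ) where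
  field
    isStrictPartialOrder : IsStrictPartialOrder _≡_ _>_
    wellFounded          : WellFounded (flip _>_)

module _ {i ℓ : Level} {I : Set i} (_>_ : Rel I ℓ) where

  ⋎₂ : I → I → Pred I ℓ
  ⋎₂ α β γ = (α > γ) ⊎ (β > γ)

  ⋎₁ : I → Pred I ℓ
  ⋎₁ α = ⋎₂ α α

record LabeledARS {a i : Level} (A : Set a) (I : Set i) (r s : Level) : Set (a ⊔ i ⊔ suc (r ⊔ s)) where
  field
    _⟶[_]_ : A → I → A → Set r
    _⊢⊣[_]_ : A → I → A → Set s

  Step : I → Rel A r
  Step α x y = x ⟶[ α ] y

  Eqv : I → Rel A s
  Eqv α x y = x ⊢⊣[ α ] y

  field
    ⊢⊣-sym : ∀ α → Symmetric (Eqv α)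

  BackStep : I → Rel A r
  BackStep α = flip (Step α)

  infix 4 _⟶_ _⟵_ _∼_ _⇔_

  _⟶_ : Rel A (i ⊔ r)
  x ⟶ y = ∃ λ α → Step α x y

  _⟵_ : Rel A (i ⊔ r)
  _⟵_ = flip _⟶_

  _∼_ : Rel A (a ⊔ i ⊔ s)
  _∼_ = Star (λ x y → ∃ λ α → Eqv α x y)

  _⇔_ : Rel A (a ⊔ i ⊔ r ⊔ s)
  _⇔_ = _⟵_ ∪ _⟶_ ∪ _∼_

  module _ {j : Level} (J : Pred I j) where

    StepIn : Rel A (i ⊔ j ⊔ r)
    StepIn x y = ∃ λ γ → γ ∈ J × Step γ x y

    EqvIn : Rel A (i ⊔ j ⊔ s)
    EqvIn x y = ∃ λ γ → γ ∈ J × Eqv γ x y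

    -- ⇔_J; unlike _⇔_, it uses single ⊢⊣-steps rather than their closure _∼_.
    ConvIn : Rel A (i ⊔ j ⊔ r ⊔ s)
    ConvIn = flip StepIn ∪ StepIn ∪ EqvIn

  PeakAndCliffDecreasing : (ℓ : Level) → Set (a ⊔ i ⊔ r ⊔ s ⊔ suc ℓ)
  PeakAndCliffDecreasing ℓ =
    ∃ λ (_>_ : Rel I ℓ) →
      IsWellFoundedOrder _>_ ×
      (∀ α β →
        ((BackStep α · Step β) ⇒ Star (ConvIn (⋎₂ _>_ α β))) ×
        ((BackStep α · Eqv β) ⇒
          (Star (ConvIn (⋎₁ _>_ α)) · ReflClosure (BackStep β))))

  ChurchRosserModulo∼ : Set (a ⊔ i ⊔ r ⊔ s)
  ChurchRosserModulo∼ = Star _⇔_ ⇒ (Star _⟶_ · _∼_ · Star _⟵_)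

{-# OPTIONS --safe #-}
module Submission where

-- Measure a conversion by the multiset of its labels. Replacing a local peak or
-- a local cliff (in either orientation) by the conversion that decreasingness
-- provides makes this multiset smaller in the multiset extension of the order
-- on labels, which is well-founded. A conversion without peaks and cliffs has
-- no ← before → or ⊢⊣ and no ⊢⊣ before →, so it has the shape →* · ∼ · ←*.

open import Data.List.Base using (List; []; _∷_; _++_)
open import Data.List.Membership.Propositional.Properties using (∈-∃++)
open import Data.List.Relation.Binary.Permutation.Propositional using (_↭_; refl; prep; ↭-refl; ↭-sym; ↭-trans; module PermutationReasoning)
open import Data.List.Relation.Binary.Permutation.Propositional.Properties using (¬x∷xs↭[]; drop-∷; shift; shifts; ++-assoc; ++⁺ˡ; ++⁺ʳ; ∈-resp-↭)
open import Data.List.Relation.Unary.All as All using (All; []; _∷_)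
open import Data.List.Relation.Unary.Any using (here; there)
open import Data.Empty using (⊥-elim)
open import Data.Product.Base using (∃; _×_; _,_; proj₁; proj₂)
open import Data.Sum.Base as Sum using (_⊎_; inj₁; inj₂)
open import Function.Base using (_∘_; flip)
open import Induction.WellFounded using (Acc; acc; WellFounded)
open import Level using (Level; _⊔_)
open import Relation.Binary.Construct.Closure.Reflexive using (ReflClosure; refl; [_])
open import Relation.Binary.Construct.Closure.ReflexiveTransitive as Star using (Star; ε; _◅_)
open import Relation.Binary.Construct.Closure.Transitive as Transitive using (TransClosure; [_]; _∷_)
open import Relation.Binary.Construct.Composition using () renaming (_;_ to _·_)
open import Relation.Binary.Core using (Rel; _⇒_)
open import Relation.Binary.Definitions using (Symmetric)
open import Relation.Binary.PropositionalEquality.Core using (_≡_; refl)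
open import Relation.Unary using (Pred)
open import Defs

-- Serves to decide, in `Acc-∷-step`, whether the replaced element is the head of a list or sits in
-- its tail.
∷↭∷-inv : ∀ {a} {A : Set a} {x y : A} {xs ys} → x ∷ xs ↭ y ∷ ys →
          (x ≡ y × xs ↭ ys) ⊎ (∃ λ zs → (xs ↭ y ∷ zs) × (ys ↭ x ∷ zs))
∷↭∷-inv {x = x} {y} {xs} {ys} p with ∈-resp-↭ (↭-sym p) (here refl)
... | here refl = inj₁ (refl , drop-∷ p)
... | there y∈xs with us , vs , refl ← ∈-∃++ y∈xs =
  inj₂ (us ++ vs , shift y us vs , drop-∷ (begin
    y ∷ ys           ↭⟨ p ⟨
    x ∷ us ++ y ∷ vs ↭⟨ shift y (x ∷ us) vs ⟩
    y ∷ x ∷ us ++ vs ∎))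
  where open PermutationReasoning

All-⊎-split : ∀ {a p q} {A : Set a} {P : Pred A p} {Q : Pred A q} {xs : List A} →
              All (λ x → P x ⊎ Q x) xs →
              ∃ λ ys → ∃ λ zs → (xs ↭ ys ++ zs) × All P ys × All Q zs
All-⊎-split [] = [] , [] , refl , [] , []
All-⊎-split (px⊎qx ∷ pqs) with px⊎qx | All-⊎-split pqs
... | inj₁ px | ys , zs , xs↭ , ps , qs = _ ∷ ys , zs , prep _ xs↭ , px ∷ ps , qs
... | inj₂ qx | ys , zs , xs↭ , ps , qs =
  ys , _ ∷ zs , ↭-trans (prep _ xs↭) (↭-sym (shift _ ys zs)) , ps , qx ∷ qs

module MultisetOrder {i ℓ} {I : Set i} (_>_ : Rel I ℓ) where

  infix 4 _≺_ _≺⁺_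

  -- One step of the multiset extension of _>_, on lists up to permutation:
  -- a single element is replaced by any number of smaller ones.
  data _≺_ (M N : List I) : Set (i ⊔ ℓ) where
    replace : ∀ α {K R} → N ↭ α ∷ R → M ↭ K ++ R → All (α >_) K → M ≺ N

  _≺⁺_ : Rel (List I) (i ⊔ ℓ)
  _≺⁺_ = TransClosure _≺_

  -- `≺` constrains the larger list only up to `↭`, so permuted lists have the same predecessors.
  Acc-resp-↭ : ∀ {M N} → M ↭ N → Acc _≺_ M → Acc _≺_ N
  Acc-resp-↭ M↭N (acc rs) =
    acc λ { (replace α N↭ L↭ α>K) → rs (replace α (↭-trans M↭N N↭) L↭ α>K) }

  Acc-++ : ∀ {K M} → All (λ β → ∀ N → Acc _≺_ N → Acc _≺_ (β ∷ N)) K →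
           Acc _≺_ M → Acc _≺_ (K ++ M)
  Acc-++ []       a = a
  Acc-++ (f ∷ fs) a = f _ (Acc-++ fs a)

  -- Inner induction, on the accessibility of `M` with `α` fixed. A predecessor of `α ∷ M` either
  -- replaces `α` by smaller labels, which `ih` adds one by one, or keeps `α` and replaces a label
  -- in `M`.
  Acc-∷-step : ∀ {α} → (∀ {γ} → α > γ → ∀ N → Acc _≺_ N → Acc _≺_ (γ ∷ N)) →
               ∀ M → Acc _≺_ M → Acc _≺_ (α ∷ M)
  Acc-∷-step {α} ih M accM@(acc rM) = acc below
    where
    below : ∀ {L} → L ≺ α ∷ M → Acc _≺_ L
    below (replace β {K} p L↭ β>K) with ∷↭∷-inv p
    ... | inj₁ (refl , M↭R) =
      Acc-resp-↭ (↭-sym L↭) (Acc-++ (All.map ih β>K) (Acc-resp-↭ M↭R accM))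
    -- Here `S` is `M` without `β`, and `L` is `α ∷ K ++ S` up to permutation with `K ++ S ≺ M`.
    ... | inj₂ (S , M↭β∷S , R↭α∷S) =
      Acc-resp-↭ (↭-sym (↭-trans L↭ (↭-trans (++⁺ˡ K R↭α∷S) (shift α K S))))
        (Acc-∷-step ih (K ++ S) (rM (replace β M↭β∷S ↭-refl β>K)))

  -- Outer induction, on the accessibility of the added label.
  Acc-∷ : ∀ {α} → Acc (flip _>_) α → ∀ M → Acc _≺_ M → Acc _≺_ (α ∷ M)
  Acc-∷ (acc rα) = Acc-∷-step (λ α>γ → Acc-∷ (rα α>γ))

  ≺-wellFounded : WellFounded (flip _>_) → WellFounded _≺_
  ≺-wellFounded wf []      = acc λ { (replace _ p _ _) → ⊥-elim (¬x∷xs↭[] (↭-sym p)) }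
  ≺-wellFounded wf (α ∷ M) = Acc-∷ (wf α) M (≺-wellFounded wf M)

  ≺-∷ : ∀ α {M N} → M ≺ N → α ∷ M ≺ α ∷ N
  ≺-∷ α (replace β {K} {R} N↭ M↭ β>K) =
    replace β
      (↭-trans (prep α N↭) (shift β (α ∷ []) R))
      (↭-trans (prep α M↭) (↭-sym (shift α K R)))
      β>K

  ≺⁺-∷ : ∀ α {M N} → M ≺⁺ N → α ∷ M ≺⁺ α ∷ N
  ≺⁺-∷ α [ M≺N ]       = [ ≺-∷ α M≺N ]
  ≺⁺-∷ α (L≺M ∷ M≺⁺N) = ≺-∷ α L≺M ∷ ≺⁺-∷ α M≺⁺N

  ++-≺-∷ : ∀ {α K} N → All (α >_) K → K ++ N ≺ α ∷ N
  ++-≺-∷ {α} N α>K = replace α ↭-refl ↭-refl α>K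

  -- Split `K` into labels below `α` and labels below `β`, then replace `α` and `β` in turn, passing
  -- through `K₁ ++ β ∷ N`.
  ++-≺⁺-∷∷ : ∀ {α β K} N → All (⋎₂ _>_ α β) K → K ++ N ≺⁺ α ∷ β ∷ N
  ++-≺⁺-∷∷ {α} {β} {K} N αβ>K with All-⊎-split αβ>K
  ... | K₁ , K₂ , K↭ , α>K₁ , β>K₂ =
    replace β (shift β K₁ N) K++N↭ β>K₂ ∷ [ ++-≺-∷ (β ∷ N) α>K₁ ]
    where
    K++N↭ : K ++ N ↭ K₂ ++ K₁ ++ N
    K++N↭ = ↭-trans (++⁺ʳ N K↭) (↭-trans (++-assoc K₁ K₂ N) (shifts K₁ K₂))

module Conversions {a i r s} {A : Set a} {I : Set i} (𝒜 : LabeledARS A I r s) where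
  open LabeledARS 𝒜

  infixr 5 _⟶∷_ _⟵∷_ _⊢⊣∷_ _++ᶜ_

  -- The labels form an index, so that the measure can be read off the type. Equivalence steps are
  -- single `⊢⊣` steps, so each one is counted.
  data Conversion : List I → Rel A (a ⊔ i ⊔ r ⊔ s) where
    []    : ∀ {x} → Conversion [] x x
    _⟶∷_  : ∀ {α N x y z} → Step α x y → Conversion N y z → Conversion (α ∷ N) x z
    _⟵∷_  : ∀ {α N x y z} → BackStep α x y → Conversion N y z → Conversion (α ∷ N) x z
    _⊢⊣∷_ : ∀ {α N x y z} → Eqv α x y → Conversion N y z → Conversion (α ∷ N) x z

  _++ᶜ_ : ∀ {M N x y z} → Conversion M x y → Conversion N y z → Conversion (M ++ N) x z
  []         ++ᶜ d = d
  (s ⟶∷ c)  ++ᶜ d = s ⟶∷ (c ++ᶜ d)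
  (s ⟵∷ c)  ++ᶜ d = s ⟵∷ (c ++ᶜ d)
  (e ⊢⊣∷ c) ++ᶜ d = e ⊢⊣∷ (c ++ᶜ d)

  fromConvIn* : ∀ {j} {J : Pred I j} {x y} → Star (ConvIn J) x y →
                ∃ λ K → All J K × Conversion K x y
  fromConvIn* ε = [] , [] , []
  fromConvIn* (step ◅ steps) with step | fromConvIn* steps
  ... | inj₁ (γ , γ∈J , s)        | K , K⊆J , c = γ ∷ K , γ∈J ∷ K⊆J , s ⟵∷ c
  ... | inj₂ (inj₁ (γ , γ∈J , s)) | K , K⊆J , c = γ ∷ K , γ∈J ∷ K⊆J , s ⟶∷ c
  ... | inj₂ (inj₂ (γ , γ∈J , e)) | K , K⊆J , c = γ ∷ K , γ∈J ∷ K⊆J , e ⊢⊣∷ c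

  from∼ : ∀ {x y} → x ∼ y → ∃ λ N → Conversion N x y
  from∼ ε              = [] , []
  from∼ ((α , e) ◅ es) = let N , c = from∼ es in α ∷ N , e ⊢⊣∷ c

  from⇔* : ∀ {x y} → Star _⇔_ x y → ∃ λ N → Conversion N x y
  from⇔* ε = [] , []
  from⇔* (step ◅ steps) with step | from⇔* steps
  ... | inj₁ (α , s)        | N , c = α ∷ N , s ⟵∷ c
  ... | inj₂ (inj₁ (α , s)) | N , c = α ∷ N , s ⟶∷ c
  ... | inj₂ (inj₂ es)      | N , c = let M , d = from∼ es in M ++ N , d ++ᶜ c

  -- Allows the conversion obtained from a cliff to be read backwards in `reduce-⊢⊣⟶`.
  ConvIn-sym : ∀ {j} {J : Pred I j} → Symmetric (ConvIn J)
  ConvIn-sym (inj₁ s)                     = inj₂ (inj₁ s)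
  ConvIn-sym (inj₂ (inj₁ s))              = inj₁ s
  ConvIn-sym (inj₂ (inj₂ (γ , γ∈J , e))) = inj₂ (inj₂ (γ , γ∈J , ⊢⊣-sym γ e))

  module Decreasing
    {ℓ} (_>_ : Rel I ℓ)
    (peak  : ∀ α β → (BackStep α · Step β) ⇒ Star (ConvIn (⋎₂ _>_ α β)))
    (cliff : ∀ α β → (BackStep α · Eqv β) ⇒
                     (Star (ConvIn (⋎₁ _>_ α)) · ReflClosure (BackStep β)))
    where
    open MultisetOrder _>_

    Smaller : List I → Rel A (a ⊔ i ⊔ r ⊔ s ⊔ ℓ)
    Smaller N x y = ∃ λ M → (M ≺⁺ N) × Conversion M x y

    under-⟶ : ∀ {α N x y z} → Step α x y → Smaller N y z → Smaller (α ∷ N) x z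
    under-⟶ s (M , M≺N , c) = _ ∷ M , ≺⁺-∷ _ M≺N , s ⟶∷ c

    under-⟵ : ∀ {α N x y z} → BackStep α x y → Smaller N y z → Smaller (α ∷ N) x z
    under-⟵ s (M , M≺N , c) = _ ∷ M , ≺⁺-∷ _ M≺N , s ⟵∷ c

    under-⊢⊣ : ∀ {α N x y z} → Eqv α x y → Smaller N y z → Smaller (α ∷ N) x z
    under-⊢⊣ e (M , M≺N , c) = _ ∷ M , ≺⁺-∷ _ M≺N , e ⊢⊣∷ c

    reduce-⟵⟶ : ∀ {α β N w x y z} → BackStep α w x → Step β x y → Conversion N y z →
                 Smaller (α ∷ β ∷ N) w z
    reduce-⟵⟶ s t c with fromConvIn* (peak _ _ (_ , s , t))
    ... | K , αβ>K , d = _ , ++-≺⁺-∷∷ _ αβ>K , d ++ᶜ c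

    reduce-⟵⊢⊣ : ∀ {α β N w x y z} → BackStep α w x → Eqv β x y → Conversion N y z →
                  Smaller (α ∷ β ∷ N) w z
    reduce-⟵⊢⊣ s e c with cliff _ _ (_ , s , e)
    ... | v , steps , t= with fromConvIn* steps | t=
    -- Both labels disappear: `K` takes the place of `α`, and nothing that of `β`.
    ...   | K , α>K , d | refl  = _ , ++-≺⁺-∷∷ _ (All.map (inj₁ ∘ Sum.reduce) α>K) , d ++ᶜ c
    -- The label `β` survives on `t`, so only `α` is replaced.
    ...   | K , α>K , d | [ t ] = _ , [ ++-≺-∷ _ (All.map Sum.reduce α>K) ] , d ++ᶜ t ⟵∷ c

    -- Read from right to left, `⊢⊣` followed by `⟶` is a cliff, because `⊢⊣` is symmetric. The
    -- conversion that `cliff` gives runs from `y` to `w` and is reversed; a final `⟵` step thereby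
    -- becomes an initial `⟶` step.
    reduce-⊢⊣⟶ : ∀ {α β N w x y z} → Eqv β w x → Step α x y → Conversion N y z →
                  Smaller (β ∷ α ∷ N) w z
    reduce-⊢⊣⟶ e s c with cliff _ _ (_ , s , ⊢⊣-sym _ e)
    ... | v , steps , t= with fromConvIn* (Star.reverse ConvIn-sym steps) | t=
    ...   | K , α>K , d | refl  = _ , ++-≺⁺-∷∷ _ (All.map (inj₂ ∘ Sum.reduce) α>K) , d ++ᶜ c
    ...   | K , α>K , d | [ t ] = _ , [ ≺-∷ _ (++-≺-∷ _ (All.map Sum.reduce α>K)) ] , t ⟶∷ (d ++ᶜ c)

    -- Only another `⟵` can continue the shape; a `⟶` or `⊢⊣` completes a peak or cliff, which is
    -- reduced on the spot.
    after-⟵ : ∀ {α N x y z} → BackStep α x y → Conversion N y z →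
               Star _⟵_ x z ⊎ Smaller (α ∷ N) x z
    after-⟵ s []         = inj₁ ((_ , s) ◅ ε)
    after-⟵ s (t ⟶∷ c)  = inj₂ (reduce-⟵⟶ s t c)
    after-⟵ s (t ⟵∷ c)  = Sum.map ((_ , s) ◅_) (under-⟵ s) (after-⟵ t c)
    after-⟵ s (e ⊢⊣∷ c) = inj₂ (reduce-⟵⊢⊣ s e c)

    after-⊢⊣ : ∀ {β N x y z} → Eqv β x y → Conversion N y z →
                (_∼_ · Star _⟵_) x z ⊎ Smaller (β ∷ N) x z
    after-⊢⊣ e []         = inj₁ (_ , (_ , e) ◅ ε , ε)
    after-⊢⊣ e (s ⟶∷ c)  = inj₂ (reduce-⊢⊣⟶ e s c)
    after-⊢⊣ e (s ⟵∷ c)  =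
      Sum.map (λ back → _ , (_ , e) ◅ ε , back) (under-⊢⊣ e) (after-⟵ s c)
    after-⊢⊣ e (f ⊢⊣∷ c) =
      Sum.map (λ (_ , es , back) → _ , (_ , e) ◅ es , back) (under-⊢⊣ e) (after-⊢⊣ f c)

    -- Scans from the left in three phases, one per factor of the composition. The phase only moves
    -- forward, and the first step that would move it back ends a peak or cliff.
    valley⊎smaller : ∀ {N x y} → Conversion N x y →
                     (Star _⟶_ · _∼_ · Star _⟵_) x y ⊎ Smaller N x y
    valley⊎smaller []         = inj₁ (_ , ε , _ , ε , ε)
    valley⊎smaller (s ⟶∷ c)  =
      Sum.map (λ (_ , steps , rest) → _ , (_ , s) ◅ steps , rest) (under-⟶ s) (valley⊎smaller c)
    valley⊎smaller (s ⟵∷ c)  = Sum.map₁ (λ back → _ , ε , _ , ε , back) (after-⟵ s c)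
    valley⊎smaller (e ⊢⊣∷ c) = Sum.map₁ (λ rest → _ , ε , rest) (after-⊢⊣ e c)

    valley : ∀ {N x y} → Acc _≺⁺_ N → Conversion N x y → (Star _⟶_ · _∼_ · Star _⟵_) x y
    valley (acc rs) c with valley⊎smaller c
    ... | inj₁ v             = v
    ... | inj₂ (_ , M≺N , d) = valley (rs M≺N) d

    churchRosser : WellFounded (flip _>_) → ChurchRosserModulo∼
    churchRosser wf steps =
      let N , c = from⇔* steps
      in valley (Transitive.wellFounded _≺_ (≺-wellFounded wf) N) c

theorem3p7 : ∀ {a i r s ℓ : Level} (A : Set a) (I : Set i) (𝒜 : LabeledARS A I r s) →
    LabeledARS.PeakAndCliffDecreasing 𝒜 ℓ →
    LabeledARS.ChurchRosserModulo∼ 𝒜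
theorem3p7 A I 𝒜 (_>_ , isWFO , decreasing) = churchRosser wellFounded
  where
  open IsWellFoundedOrder isWFO
  open Conversions.Decreasing 𝒜 _>_ (λ α β → proj₁ (decreasing α β)) (λ α β → proj₂ (decreasing α β))
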